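{- Let $G$ be a connected (finite, simple) graph. Suppose that all the holes in $G$ are pairwise edge-disjoint and that $G$ has at most one non-edge maximal clique. Let $h(G)$ denote the number of holes in $G$. If the clique number $\omega(G)$ satisfies $2\le\omega(G)\le h(G)+1$, then $k(G)\le h(G)-\omega(G)+3$.
   Context: A hole of a graph is a chordless cycle (a cycle that is an induced subgraph) of length at least $4$. A clique is a complete subgraph; a clique $K$ is non-edge if $|V(K)|\ge 3$; the clique number $\omega(G)$ is the maximum number of vertices of a clique of $G$. For a digraph $D=(V,A)$, the competition graph $C(D)$ has vertex set $V$, with distinct $x,y$ adjacent iff there is $v\in V$ with arcs $(x,v),(y,v)\in A$. The competition number $k(G)$ of a graph $G$ is the smallest integer $k\ge 0$ such that $G$ together with $k$ new isolated vertices is the competition graph of an acyclic digraph. -}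

module Defs where

open import Data.Bool using (Bool; true; false)
open import Data.Nat using (ℕ; zero; suc; _+_; _≤_)
open import Data.Fin using (Fin; toℕ; _↑ˡ_; _↑ʳ_; splitAt)
open import Data.Fin.Subset using (Subset; _∈_; _∉_; _⊆_; ∣_∣)
open import Data.Sum using (_⊎_; inj₁; inj₂)
open import Data.Product using (Σ; ∃; _×_; _,_)
open import Data.List using (List; length)
open import Data.List.Relation.Unary.Unique.Propositional using (Unique)
import Data.List.Membership.Propositional as LM
open import Relation.Nullary using (¬_)
open import Relation.Binary.PropositionalEquality using (_≡_; _≢_)
open import Relation.Binary.Construct.Closure.ReflexiveTransitive using (Star)
open import Relation.Binary.Construct.Closure.Transitive using (TransClosure)
open import Function using (Injective)
open import Function.Bundles using (_⇔_)

Graph : ℕ → Set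
Graph n = Fin n → Fin n → Bool

Adj : ∀ {n} → Graph n → Fin n → Fin n → Set
Adj G x y = G x y ≡ true

record Simple {n} (G : Graph n) : Set where
  field
    irrefl : ∀ x → G x x ≡ false
    sym    : ∀ x y → G x y ≡ G y x

Connected : ∀ {n} → Graph n → Set
Connected G = ∀ x y → Star (Adj G) x y

-- Holes: vertex sets S with |S| ≥ 4 whose induced subgraph is a cycle.
-- (A hole, being an induced subgraph, is determined by its vertex set.)

CycNeighbours : (k : ℕ) → Fin k → Fin k → Set
CycNeighbours k i j = CycSucc k i j ⊎ CycSucc k j i
  where
  CycSucc : (k : ℕ) → Fin k → Fin k → Set
  CycSucc k i j = (toℕ j ≡ suc (toℕ i)) ⊎ (suc (toℕ i) ≡ k × toℕ j ≡ 0)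

IsHole : ∀ {n} → Graph n → Subset n → Set
IsHole {n} G S =
  4 ≤ ∣ S ∣ ×
  Σ (Fin ∣ S ∣ → Fin n) λ v →
    Injective _≡_ _≡_ v ×
    (∀ i → v i ∈ S) ×
    (∀ x → x ∈ S → ∃ λ i → v i ≡ x) ×
    (∀ i j → Adj G (v i) (v j) ⇔ CycNeighbours ∣ S ∣ i j)

HolesEdgeDisjoint : ∀ {n} → Graph n → Set
HolesEdgeDisjoint G = ∀ S T → IsHole G S → IsHole G T → S ≢ T →
  ∀ x y → x ∈ S → y ∈ S → x ∈ T → y ∈ T → ¬ Adj G x y

HoleCount : ∀ {n} → Graph n → ℕ → Set
HoleCount {n} G h = Σ (List (Subset n)) λ L →
  Unique L × (∀ S → (S LM.∈ L) ⇔ IsHole G S) × length L ≡ h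

IsClique : ∀ {n} → Graph n → Subset n → Set
IsClique G K = ∀ x y → x ∈ K → y ∈ K → x ≢ y → Adj G x y

IsMaximalClique : ∀ {n} → Graph n → Subset n → Set
IsMaximalClique G K = IsClique G K × (∀ K′ → IsClique G K′ → K ⊆ K′ → K′ ⊆ K)

AtMostOneNonEdgeMaximalClique : ∀ {n} → Graph n → Set
AtMostOneNonEdgeMaximalClique G = ∀ K₁ K₂ →
  IsMaximalClique G K₁ → 3 ≤ ∣ K₁ ∣ →
  IsMaximalClique G K₂ → 3 ≤ ∣ K₂ ∣ → K₁ ≡ K₂

CliqueNumber : ∀ {n} → Graph n → ℕ → Set
CliqueNumber G ω = (∃ λ K → IsClique G K × ∣ K ∣ ≡ ω) ×
                   (∀ K → IsClique G K → ∣ K ∣ ≤ ω)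

Digraph : ℕ → Set₁
Digraph m = Fin m → Fin m → Set

Acyclic : ∀ {m} → Digraph m → Set
Acyclic D = ∀ x → ¬ TransClosure D x x

IsCompetitionGraph : ∀ {m} → Graph m → Digraph m → Set
IsCompetitionGraph G D = ∀ x y → x ≢ y → Adj G x y ⇔ (∃ λ v → D x v × D y v)

addIsolated : ∀ {n} → Graph n → (k : ℕ) → Graph (n + k)
addIsolated {n} G k x y with splitAt n x | splitAt n y
... | inj₁ a | inj₁ b = G a b
... | _      | _      = false

CompRepresentable : ∀ {n} → Graph n → ℕ → Set₁
CompRepresentable {n} G k =
  Σ (Digraph (n + k)) λ D → Acyclic D × IsCompetitionGraph (addIsolated G k) D

-- k(G) ≤ b  (k(G) is the least k with CompRepresentable G k)
CompetitionNumber≤ : ∀ {n} → Graph n → ℕ → Set₁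
CompetitionNumber≤ G b = Σ ℕ λ k → k ≤ b × CompRepresentable G k

{-# OPTIONS --safe #-}
-- Let K be a maximum clique; by hypothesis every triangle lies in K. Choose n − ω edges which,
-- together with K, connect G. Every other edge e outside K lies in a hole (close up an induced
-- path of G − e), and since holes are edge-disjoint, different such edges lie in different
-- holes. Hence at most n − ω + h edges lie outside K, and they form with K an edge clique
-- cover of at most n − ω + h + 1 cliques.
--
-- Order the vertices and the cliques so that the j-th clique (counting from 0) lies among the
-- first j + 2 vertices; it may then prey on the next vertex, or on a new vertex once the old
-- ones are used up. Such an order exists up to padding by empty sets: start with a subgraph
-- of minimum degree ≥ 2, add vertices having at most one earlier neighbour, and take K
-- last. Padding is only needed when it leaves a total of n sets, for which two new vertices
-- suffice; this is where ω ≤ h + 1 enters.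

module Submission where

open import Defs
open import Data.Bool using (true; not; _∧_)
import Data.Bool.Properties as Bool
open import Data.Empty using (⊥-elim)
open import Data.Fin using (Fin; zero; suc; toℕ; _↑ˡ_; _↑ʳ_; splitAt; fromℕ<)
open import Data.Fin.Properties using (_≟_; any?; all?; toℕ-fromℕ<; splitAt-↑ˡ; splitAt-↑ʳ; splitAt⁻¹-↑ˡ; ↑ˡ-injective; ↑ʳ-injective)
open import Data.Fin.Subset using (Subset; _∈_; _∉_; _⊆_; ∣_∣; ⁅_⁆; _∪_; _-_; inside; outside; ⊥; ⊤)
open import Data.Fin.Subset.Properties using (x∈⁅x⁆; x∈⁅y⁆⇒x≡y; x∈p∪q⁻; x∈p∪q⁺; ∪-comm; ∪-identityˡ; ∉⊥; ∣⊥∣≡0; ∣p∣≤n; _∈?_; ∈⊤; p⊆q⇒∣p∣≤∣q∣; x∈p∧x≢y⇒x∈p-y; x∈p⇒∣p-x∣<∣p∣; p─q⊆p; p⊂q⇒∣p∣<∣q∣; ∣⊤∣≡n; nonempty?; Empty-unique)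
open import Data.List using (List; []; _∷_; _++_; length; lookup; map; filter)
import Data.List.Membership.DecPropositional as DecMembership
import Data.List.Membership.Propositional as Membership
open import Data.List.Membership.Propositional using () renaming (_∈_ to _∈ₗ_; _∉_ to _∉ₗ_)
open import Data.List.Membership.Propositional.Properties using (∈-lookup; ∈-++⁺ˡ; ∈-++⁺ʳ; ∈-map⁺; ∈-map⁻; ∈-++⁻; ∈-filter⁺; ∈-filter⁻; ∈-length)
open import Data.List.Properties using (length-++; length-map)
import Data.List.Relation.Unary.All as All
open import Data.List.Relation.Unary.All using ([]; _∷_)
open import Data.List.Relation.Unary.AllPairs using ([]; _∷_)
import Data.List.Relation.Unary.Any as Any
open import Data.List.Relation.Unary.Any using (here; there; index)
open import Data.List.Relation.Unary.Any.Properties using (lookup-index)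
open import Data.List.Relation.Unary.Unique.Propositional using (Unique)
import Data.List.Relation.Unary.Unique.Propositional.Properties as Unique
open import Data.Nat using (ℕ; zero; suc; _+_; _∸_; _≤_; _<_; z≤n; s≤s)
open import Data.Nat.Properties using (suc-injective; +-suc; <⇒≱; m≤m+n; ≤-trans; ≤-refl; ≤-reflexive; <-irrefl; <-trans; <-≤-trans; ≤-antisym; ≰⇒>; m≤n⇒m≤1+n; +-monoˡ-≤; +-monoʳ-≤; +-cancelˡ-<; m+[n∸m]≡n; m≤n+m; +-comm; +-assoc; ≤-pred; _<?_; _≤?_; +-cancelʳ-≤; m∸n+n≡m; ≮⇒≥; module ≤-Reasoning)
open import Data.Product using (∃; _×_; _,_; proj₁; proj₂; ∃₂)
open import Data.Sum using (_⊎_; inj₁; inj₂)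
open import Data.Vec using (_∷_; here; there)
open import Data.Vec.Properties using (≡-dec)
open import Function using (_∘_; Injective)
open import Function.Bundles using (_⇔_; mk⇔; Equivalence)
import Relation.Binary.Construct.Closure.ReflexiveTransitive as Star
open import Relation.Binary.Construct.Closure.ReflexiveTransitive using (Star; ε; _◅_; _◅◅_)
open import Relation.Binary.Construct.Closure.Transitive using (TransClosure; [_]; _∷_)
open import Relation.Binary.Definitions using (DecidableEquality)
open import Relation.Binary.PropositionalEquality using (_≡_; _≢_; refl; sym; trans; cong; cong₂; subst)
open import Relation.Nullary using (¬_; Dec; yes; no; does)
open import Relation.Nullary.Decidable using (dec-false; ¬?; decidable-stable; _×-dec_; _→-dec_)

private variable
  n : ℕ
  x y u v a b : Fin n
  p : Subset n
  l : List (Fin n)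

open module FinMembership {n} = DecMembership (_≟_ {n}) using () renaming (_∈?_ to _∈ₗ?_)

-- Finite subsets, lists and unordered pairs of vertices

_≟ₛ_ : DecidableEquality (Subset n)
_≟ₛ_ = ≡-dec Bool._≟_

open module SubsetMembership {n} = DecMembership (_≟ₛ_ {n}) using () renaming (_∈?_ to _∈ₛ?_)

∣⁅x⁆∪p∣ : ∀ (x : Fin n) p → x ∉ p → ∣ ⁅ x ⁆ ∪ p ∣ ≡ suc ∣ p ∣
∣⁅x⁆∪p∣ zero    (inside  ∷ p) x∉p = ⊥-elim (x∉p here)
∣⁅x⁆∪p∣ zero    (outside ∷ p) x∉p = cong (suc ∘ ∣_∣) (∪-identityˡ p)
∣⁅x⁆∪p∣ (suc x) (inside  ∷ p) x∉p = cong suc (∣⁅x⁆∪p∣ x p (x∉p ∘ there))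
∣⁅x⁆∪p∣ (suc x) (outside ∷ p) x∉p = ∣⁅x⁆∪p∣ x p (x∉p ∘ there)

fromList : List (Fin n) → Subset n
fromList []      = ⊥
fromList (x ∷ l) = ⁅ x ⁆ ∪ fromList l

∈-fromList⁺ : x ∈ₗ l → x ∈ fromList l
∈-fromList⁺ {x = x} (here refl) = x∈p∪q⁺ (inj₁ (x∈⁅x⁆ x))
∈-fromList⁺ (there x∈l) = x∈p∪q⁺ (inj₂ (∈-fromList⁺ x∈l))

∈-fromList⁻ : ∀ (l : List (Fin n)) → x ∈ fromList l → x ∈ₗ l
∈-fromList⁻ [] x∈ = ⊥-elim (∉⊥ x∈)
∈-fromList⁻ (y ∷ l) x∈ with x∈p∪q⁻ ⁅ y ⁆ (fromList l) x∈
... | inj₁ q = here (x∈⁅y⁆⇒x≡y y q)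
... | inj₂ q = there (∈-fromList⁻ l q)

-- Edges are handled as subsets: orientation disappears, equality is decidable, and `e ⊆ S` says
-- that `S` contains both ends.
pair : Fin n → Fin n → Subset n
pair u v = ⁅ u ⁆ ∪ ⁅ v ⁆

∈-pairˡ : ∀ (u v : Fin n) → u ∈ pair u v
∈-pairˡ u v = x∈p∪q⁺ (inj₁ (x∈⁅x⁆ u))

∈-pairʳ : ∀ (u v : Fin n) → v ∈ pair u v
∈-pairʳ u v = x∈p∪q⁺ (inj₂ (x∈⁅x⁆ v))

∈-pair⁻ : x ∈ pair u v → x ≡ u ⊎ x ≡ v
∈-pair⁻ {u = u} {v} x∈ with x∈p∪q⁻ ⁅ u ⁆ ⁅ v ⁆ x∈
... | inj₁ q = inj₁ (x∈⁅y⁆⇒x≡y u q)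
... | inj₂ q = inj₂ (x∈⁅y⁆⇒x≡y v q)

pair-comm : ∀ (u v : Fin n) → pair u v ≡ pair v u
pair-comm u v = ∪-comm ⁅ u ⁆ ⁅ v ⁆

pair-injective : u ≢ v → pair u v ≡ pair a b → (u ≡ a × v ≡ b) ⊎ (u ≡ b × v ≡ a)
pair-injective {u = u} {v} {a} {b} u≢v eq
  with ∈-pair⁻ (subst (u ∈_) eq (∈-pairˡ u v)) | ∈-pair⁻ (subst (v ∈_) eq (∈-pairʳ u v))
... | inj₁ p | inj₁ q = ⊥-elim (u≢v (trans p (sym q)))
... | inj₁ p | inj₂ q = inj₁ (p , q)
... | inj₂ p | inj₁ q = inj₂ (p , q)
... | inj₂ p | inj₂ q = ⊥-elim (u≢v (trans p (sym q)))

pair-⊆ : u ∈ p → v ∈ p → pair u v ⊆ p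
pair-⊆ u∈ v∈ x∈ with ∈-pair⁻ x∈
... | inj₁ refl = u∈
... | inj₂ refl = v∈

module _ {G : Graph n} (simple : Simple G) where
  Adj-sym : Adj G x y → Adj G y x
  Adj-sym {x = x} {y} e = trans (sym (Simple.sym simple x y)) e

  Adj⇒≢ : Adj G x y → x ≢ y
  Adj⇒≢ {x = x} e refl with trans (sym e) (Simple.irrefl simple x)
  ... | ()

-- Induced paths

-- Chords are excluded vertex by vertex: among the later vertices `l`, only the successor `y` is
-- adjacent to `x`. Suffixes therefore stay induced at once.
data InducedPath (H : Graph n) : Fin n → Fin n → List (Fin n) → Set where
  single : ∀ x → InducedPath H x x (x ∷ [])
  cons   : Adj H x y → x ∉ₗ l → (∀ {z} → z ∈ₗ l → Adj H x z → z ≡ y) →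
           InducedPath H y v l → InducedPath H x v (x ∷ l)

module _ {H : Graph n} where

  head∈ : InducedPath H u v l → u ∈ₗ l
  head∈ (single _)     = here refl
  head∈ (cons _ _ _ _) = here refl

  last∈ : InducedPath H u v l → v ∈ₗ l
  last∈ (single _)     = here refl
  last∈ (cons _ _ _ p) = there (last∈ p)

  path-unique : InducedPath H u v l → Unique l
  path-unique (single _)       = [] ∷ []
  path-unique (cons _ u∉l _ p) =
    All.tabulate (λ { z∈l refl → u∉l z∈l }) ∷ path-unique p

  suffix : InducedPath H u v l → a ∈ₗ l →
    ∃ λ l′ → InducedPath H a v l′ × (∀ {z} → z ∈ₗ l′ → z ∈ₗ l)
  suffix p@(single _)     (here refl) = _ , p , λ z∈ → z∈
  suffix p@(cons _ _ _ _) (here refl) = _ , p , λ z∈ → z∈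
  suffix (cons _ _ _ p)   (there a∈) with suffix p a∈
  ... | l′ , q , l′⊆l = l′ , q , there ∘ l′⊆l

  -- The last component holds because `v` occurs only at the very end, so cutting any earlier loses
  -- it.
  prefix : InducedPath H u v l → b ∈ₗ l →
    ∃ λ l′ → InducedPath H u b l′ × (∀ {z} → z ∈ₗ l′ → z ∈ₗ l) × (v ∈ₗ l′ → b ≡ v)
  prefix p@(single _)     (here refl) = _ , p , (λ z∈ → z∈) , λ _ → refl
  prefix (cons _ u∉l _ p) (here refl) =
    _ , single _ , (λ { (here refl) → here refl }) ,
    λ { (here refl) → refl }
  prefix (cons {l = l} u~y u∉l ind p) (there b∈) with prefix p b∈
  ... | l′ , q , l′⊆l , end = _ , cons u~y (u∉l ∘ l′⊆l) (ind ∘ l′⊆l) q ,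
    (λ { (here refl) → here refl ; (there z∈) → there (l′⊆l z∈) }) ,
    (λ { (here refl) → ⊥-elim (u∉l (last∈ p)) ; (there v∈) → end v∈ })

  -- Which of `a` and `b` comes first is unknown, hence the two directions. The last component
  -- singles out the whole path: any shorter part misses `u` or `v`.
  subpath : InducedPath H u v l → a ∈ₗ l → b ∈ₗ l →
    ∃ λ l′ → (InducedPath H a b l′ ⊎ InducedPath H b a l′) ×
      (∀ {z} → z ∈ₗ l′ → z ∈ₗ l) × (u ∈ₗ l′ → v ∈ₗ l′ → pair a b ≡ pair u v)
  subpath p@(single _) (here refl) (here refl) = _ , inj₁ p , (λ z∈ → z∈) , λ _ _ → refl
  subpath {u = u} p@(cons _ _ _ _) (here refl) b∈ with prefix p b∈
  ... | l′ , q , l′⊆l , end = l′ , inj₁ q , l′⊆l , λ _ v∈ → cong (pair u) (end v∈)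
  subpath {u = u} p@(cons _ _ _ _) a∈@(there _) (here refl) with prefix p a∈
  ... | l′ , q , l′⊆l , end = l′ , inj₂ q , l′⊆l ,
    λ _ v∈ → trans (pair-comm _ u) (cong (pair u) (end v∈))
  subpath (cons _ u∉l _ p) (there a∈) (there b∈) with subpath p a∈ b∈
  ... | l′ , q , l′⊆l , _ = l′ , q , there ∘ l′⊆l , λ u∈ _ → ⊥-elim (u∉l (l′⊆l u∈))

  -- Cutting the path at the last neighbour of `x` leaves a suffix that `x` can precede without
  -- creating a chord.
  lastNeighbour : ∀ x → InducedPath H u v l → a ∈ₗ l → Adj H x a →
    ∃₂ λ z l′ → InducedPath H z v l′ × Adj H x z ×
      (∀ {w} → w ∈ₗ l′ → w ∈ₗ l) × (∀ {w} → w ∈ₗ l′ → Adj H x w → w ≡ z)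
  lastNeighbour x p@(single _) (here refl) x~a =
    _ , _ , p , x~a , (λ w∈ → w∈) , λ { (here refl) _ → refl }
  lastNeighbour {u = u} x p@(cons {l = l} _ _ _ q) a∈ x~a with Any.any? (λ w → H x w Bool.≟ true) l
  ... | yes any with Membership.find any
  ...   | w , w∈ , x~w with lastNeighbour x q w∈ x~w
  ...     | z , l′ , r , x~z , l′⊆l , last = z , l′ , r , x~z , there ∘ l′⊆l , last
  lastNeighbour x p@(cons _ _ _ q) (there a∈) x~a | no none = ⊥-elim (none (Any.map (λ { refl → x~a }) a∈))
  lastNeighbour x p@(cons _ _ _ q) (here refl) x~a | no none =
    _ , _ , p , x~a , (λ w∈ → w∈) ,
    λ { (here refl) _ → refl ; (there w∈) x~w → ⊥-elim (none (Any.map (λ { refl → x~w }) w∈)) }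

  -- Shorten the walk from its far end: if `u` already lies on the induced path found for the rest,
  -- start there; otherwise jump from `u` to its last neighbour on it.
  inducedPath : Star (Adj H) u v → ∃ (InducedPath H u v)
  inducedPath ε = _ , single _
  inducedPath {u = u} (u~y ◅ w) with inducedPath w
  ... | l , p with u ∈ₗ? l
  ...   | yes u∈l with suffix p u∈l
  ...     | l′ , q , _ = l′ , q
  inducedPath {u = u} (u~y ◅ w) | l , p | no u∉l with lastNeighbour u p (head∈ p) u~y
  ... | z , l′ , q , u~z , l′⊆l , last = _ , cons u~z (u∉l ∘ l′⊆l) last q

  lookup-head : ∀ {l} → InducedPath H u v l → ∀ i → lookup l i ≡ u → toℕ i ≡ 0
  lookup-head (single _)       zero    _    = refl
  lookup-head (cons _ _ _ _)   zero    _    = refl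
  lookup-head (cons _ u∉l _ _) (suc i) refl = ⊥-elim (u∉l (∈-lookup i))

  lookup-0 : ∀ {l} → InducedPath H u v l → ∀ i → toℕ i ≡ 0 → lookup l i ≡ u
  lookup-0 (single _)     zero _ = refl
  lookup-0 (cons _ _ _ _) zero _ = refl

  lookup-last : ∀ {l} → InducedPath H u v l → ∀ i → lookup l i ≡ v → suc (toℕ i) ≡ length l
  lookup-last (single _)       zero    _    = refl
  lookup-last (cons _ u∉l _ p) zero    refl = ⊥-elim (u∉l (last∈ p))
  lookup-last (cons _ _ _ p)   (suc i) eq   = cong suc (lookup-last p i eq)

  lookup-end : ∀ {l} → InducedPath H u v l → ∀ i → suc (toℕ i) ≡ length l → lookup l i ≡ v
  lookup-end (single _)              zero    _  = refl
  lookup-end (cons _ _ _ (single _)) (suc zero) _ = refl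
  lookup-end (cons _ _ _ p@(cons _ _ _ _)) (suc i) eq = lookup-end p i (suc-injective eq)

  lookup-injective : ∀ {l} → InducedPath H u v l → Injective _≡_ _≡_ (lookup l)
  lookup-injective (single _)       {zero}  {zero}  _  = refl
  lookup-injective (cons _ _ _ _)   {zero}  {zero}  _  = refl
  lookup-injective (cons _ u∉l _ _) {zero}  {suc j} eq = ⊥-elim (u∉l (subst (_∈ₗ _) (sym eq) (∈-lookup j)))
  lookup-injective (cons _ u∉l _ _) {suc i} {zero}  eq = ⊥-elim (u∉l (subst (_∈ₗ _) eq (∈-lookup i)))
  lookup-injective (cons _ _ _ p)   {suc i} {suc j} eq = cong suc (lookup-injective p eq)

  module _ (simple : Simple H) where
    lookup-Adj⇒ : ∀ {l} → InducedPath H u v l → ∀ i j → Adj H (lookup l i) (lookup l j) →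
      toℕ j ≡ suc (toℕ i) ⊎ toℕ i ≡ suc (toℕ j)
    lookup-Adj⇒ (single _) zero zero i~j = ⊥-elim (Adj⇒≢ simple i~j refl)
    lookup-Adj⇒ (cons _ _ _ _) zero zero i~j = ⊥-elim (Adj⇒≢ simple i~j refl)
    lookup-Adj⇒ (cons _ _ ind p) zero (suc j) i~j =
      inj₁ (cong suc (lookup-head p j (ind (∈-lookup j) i~j)))
    lookup-Adj⇒ (cons _ _ ind p) (suc i) zero i~j =
      inj₂ (cong suc (lookup-head p i (ind (∈-lookup i) (Adj-sym simple i~j))))
    lookup-Adj⇒ (cons _ _ _ p) (suc i) (suc j) i~j with lookup-Adj⇒ p i j i~j
    ... | inj₁ eq = inj₁ (cong suc eq)
    ... | inj₂ eq = inj₂ (cong suc eq)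

  lookup-consecutive : ∀ {l} → InducedPath H u v l → ∀ i j → toℕ j ≡ suc (toℕ i) →
    Adj H (lookup l i) (lookup l j)
  lookup-consecutive (single _) zero zero ()
  lookup-consecutive (cons u~y _ _ p) zero (suc j) eq =
    subst (Adj H _) (sym (lookup-0 p j (suc-injective eq))) u~y
  lookup-consecutive (cons _ _ _ p) (suc i) (suc j) eq =
    lookup-consecutive p i j (suc-injective eq)

-- From induced paths to holes

∣fromList∣ : Unique l → ∣ fromList l ∣ ≡ length l
∣fromList∣ {n} {[]} [] = ∣⊥∣≡0 n
∣fromList∣ {n} {x ∷ l} (x≢ ∷ uniq) =
  trans (∣⁅x⁆∪p∣ x (fromList l) λ x∈ → All.lookup x≢ (∈-fromList⁻ l x∈) refl)
        (cong suc (∣fromList∣ uniq))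

-- Keeping the length `k` apart from `∣ S ∣` allows indexing by positions in a list, without
-- transporting functions along an equality of sizes.
isHole : ∀ {G : Graph n} {S k} → ∣ S ∣ ≡ k → 4 ≤ k → (w : Fin k → Fin n) →
  Injective _≡_ _≡_ w → (∀ i → w i ∈ S) → (∀ x → x ∈ S → ∃ λ i → w i ≡ x) →
  (∀ i j → Adj G (w i) (w j) ⇔ CycNeighbours k i j) → IsHole G S
isHole refl 4≤k w inj w∈ onto adj = 4≤k , w , inj , w∈ , onto , adj

-- The path closes up with the edge from `u` to `v`. One vertex would be a loop, two would make `u`
-- and `v` adjacent in `H`, three would form a triangle; so there are at least four. Any edge of `G`
-- among them is an edge of the induced path or the closing edge.
cycle⇒hole : ∀ {G H : Graph n} → Simple G → Simple H →
  InducedPath H u v l → Adj G u v → (∀ {a b} → Adj H a b → Adj G a b) → ¬ Adj H u v →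
  (∀ w → Adj G u w → ¬ Adj G w v) →
  (∀ {a b} → a ∈ₗ l → b ∈ₗ l → Adj G a b → Adj H a b ⊎ pair a b ≡ pair u v) →
  IsHole G (fromList l)
cycle⇒hole {u = u} {v} {l} {G} {H} sG sH path u~v H⊆G u≁v noTriangle chordless =
  isHole {G = G} (∣fromList∣ (path-unique path)) (long path u~v u≁v noTriangle) (lookup l)
    (lookup-injective path) (λ i → ∈-fromList⁺ {l = l} (∈-lookup i))
    (λ x x∈ → let x∈l = ∈-fromList⁻ l x∈ in index x∈l , sym (lookup-index x∈l))
    λ i j → mk⇔ (to i j) (from i j)
  where
  long : ∀ {l u v} → InducedPath H u v l → Adj G u v → ¬ Adj H u v →
    (∀ w → Adj G u w → ¬ Adj G w v) → 4 ≤ length l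
  long (single _) u~v _ _ = ⊥-elim (Adj⇒≢ sG u~v refl)
  long (cons u~v _ _ (single _)) _ u≁v _ = ⊥-elim (u≁v u~v)
  long (cons u~w _ _ (cons w~v _ _ (single _))) _ _ noTriangle =
    ⊥-elim (noTriangle _ (H⊆G u~w) (H⊆G w~v))
  long (cons _ _ _ (cons _ _ _ (cons _ _ _ (single _)))) _ _ _ = s≤s (s≤s (s≤s (s≤s z≤n)))
  long (cons _ _ _ (cons _ _ _ (cons _ _ _ (cons _ _ _ _)))) _ _ _ = s≤s (s≤s (s≤s (s≤s z≤n)))

  to : ∀ i j → Adj G (lookup l i) (lookup l j) → CycNeighbours (length l) i j
  to i j i~j with chordless (∈-lookup i) (∈-lookup j) i~j
  ... | inj₁ i~j′ with lookup-Adj⇒ sH path i j i~j′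
  ...   | inj₁ eq = inj₁ (inj₁ eq)
  ...   | inj₂ eq = inj₂ (inj₁ eq)
  to i j i~j | inj₂ eq with pair-injective (Adj⇒≢ sG i~j) eq
  ... | inj₁ (i≡u , j≡v) = inj₂ (inj₂ (lookup-last path j j≡v , lookup-head path i i≡u))
  ... | inj₂ (i≡v , j≡u) = inj₁ (inj₂ (lookup-last path i i≡v , lookup-head path j j≡u))

  closing : ∀ i j → suc (toℕ i) ≡ length l → toℕ j ≡ 0 → Adj G (lookup l j) (lookup l i)
  closing i j i≡end j≡0 rewrite lookup-0 path j j≡0 | lookup-end path i i≡end = u~v

  from : ∀ i j → CycNeighbours (length l) i j → Adj G (lookup l i) (lookup l j)
  from i j (inj₁ (inj₁ eq)) = H⊆G (lookup-consecutive path i j eq)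
  from i j (inj₁ (inj₂ (p , q))) = Adj-sym sG (closing i j p q)
  from i j (inj₂ (inj₁ eq)) = Adj-sym sG (H⊆G (lookup-consecutive path j i eq))
  from i j (inj₂ (inj₂ (p , q))) = closing j i p q

-- Holes through edges outside K

-- Two edges are deleted so that two extra edges can be compared; taking `e` and `f` equal deletes
-- just one.
avoid : Graph n → Subset n → Subset n → Graph n
avoid G e f u v = G u v ∧ not (does (pair u v ≟ₛ e)) ∧ not (does (pair u v ≟ₛ f))

module _ (G : Graph n) {e f : Subset n} where

  avoid⁺ : Adj G u v → pair u v ≢ e → pair u v ≢ f → Adj (avoid G e f) u v
  avoid⁺ {u = u} {v} u~v ≢e ≢f
    rewrite u~v | dec-false (pair u v ≟ₛ e) ≢e | dec-false (pair u v ≟ₛ f) ≢f = refl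

  avoid⁻ : Adj (avoid G e f) u v → Adj G u v × pair u v ≢ e × pair u v ≢ f
  avoid⁻ {u = u} {v} u~v with G u v | pair u v ≟ₛ e | pair u v ≟ₛ f
  ... | true | no ≢e | no ≢f = refl , ≢e , ≢f

  avoid-simple : Simple G → Simple (avoid G e f)
  avoid-simple sG = record
    { irrefl = λ x → cong (_∧ _) (Simple.irrefl sG x)
    ; sym    = λ x y → trans (cong (_∧ _) (Simple.sym sG x y))
                 (cong (λ s → G y x ∧ not (does (s ≟ₛ e)) ∧ not (does (s ≟ₛ f))) (pair-comm x y)) }

-- All of `K` counts as connected beforehand, so a suitable `P` needs only one edge for each vertex
-- outside `K`.
Link : Graph n → Subset n → List (Subset n) → Fin n → Fin n → Set
Link G K P u v = (u ∈ K × v ∈ K × u ≢ v) ⊎ (Adj G u v × pair u v ∈ₗ P)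

OuterEdge : Graph n → Subset n → Subset n → Set
OuterEdge G K e = ∃₂ λ u v → e ≡ pair u v × Adj G u v × ¬ (u ∈ K × v ∈ K)

module Extra {G : Graph n} (sG : Simple G) {K : Subset n} (clique : IsClique G K)
  (triangle⊆K : ∀ {u v w} → Adj G u v → Adj G u w → Adj G w v → u ∈ K × v ∈ K)
  (disjoint : HolesEdgeDisjoint G)
  {P : List (Subset n)} (spanning : ∀ u v → Star (Link G K P) u v) where

  ExtraEdge : Subset n → Set
  ExtraEdge e = OuterEdge G K e × e ∉ₗ P

  -- Deleting extra edges leaves every link intact: a link inside `K` is no outer edge, and one
  -- listed in `P` is not extra. Hence the graph stays connected.
  Link⇒avoid : ∀ {e f} → ExtraEdge e → ExtraEdge f → Link G K P x y → Adj (avoid G e f) x y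
  Link⇒avoid {x = x} {y} (outer-e , e∉P) (outer-f , f∉P) (inj₁ (x∈K , y∈K , x≢y)) =
    avoid⁺ G (clique _ _ x∈K y∈K x≢y) (≢outer outer-e) (≢outer outer-f)
    where
    ≢outer : ∀ {g} → OuterEdge G K g → pair x y ≢ g
    ≢outer (u , v , refl , u~v , ¬K) eq with pair-injective x≢y eq
    ... | inj₁ (refl , refl) = ¬K (x∈K , y∈K)
    ... | inj₂ (refl , refl) = ¬K (y∈K , x∈K)
  Link⇒avoid (outer-e , e∉P) (outer-f , f∉P) (inj₂ (x~y , xy∈P)) =
    avoid⁺ G x~y (λ { refl → e∉P xy∈P }) (λ { refl → f∉P xy∈P })

  avoidingPath : ∀ {e f} → ExtraEdge e → ExtraEdge f → ∀ u v →
    ∃ (InducedPath (avoid G e f) u v)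
  avoidingPath xe xf u v = inducedPath (Star.map (Link⇒avoid xe xf) (spanning u v))

  -- The closing edge is one of the two deleted ones, and the last hypothesis keeps the other from
  -- being a chord. A triangle on the closing edge would put both its ends into `K`.
  close : ∀ {e f} → Adj G u v → ¬ (u ∈ K × v ∈ K) → pair u v ≡ e ⊎ pair u v ≡ f →
    InducedPath (avoid G e f) u v l →
    (∀ {a b} → a ∈ₗ l → b ∈ₗ l → a ≢ b → pair a b ≡ e ⊎ pair a b ≡ f → pair a b ≡ pair u v) →
    IsHole G (fromList l)
  close {u = u} {v} {e = e} {f} u~v ¬K closing path only =
    cycle⇒hole sG (avoid-simple G sG) path u~v (proj₁ ∘ avoid⁻ G) (u≁v closing)
      (λ w u~w w~v → ¬K (triangle⊆K u~v u~w w~v)) chordless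
    where
    u≁v : pair u v ≡ e ⊎ pair u v ≡ f → ¬ Adj (avoid G e f) u v
    u≁v (inj₁ eq) u~v = proj₁ (proj₂ (avoid⁻ G u~v)) eq
    u≁v (inj₂ eq) u~v = proj₂ (proj₂ (avoid⁻ G u~v)) eq
    chordless : ∀ {a b} → a ∈ₗ _ → b ∈ₗ _ → Adj G a b →
      Adj (avoid G e f) a b ⊎ pair a b ≡ pair u v
    chordless {a} {b} a∈ b∈ a~b = decide (pair a b ≟ₛ e) (pair a b ≟ₛ f)
      where
      decide : Dec (pair a b ≡ e) → Dec (pair a b ≡ f) → _
      decide (yes ≡e) _ = inj₂ (only a∈ b∈ (Adj⇒≢ sG a~b) (inj₁ ≡e))
      decide (no _) (yes ≡f) = inj₂ (only a∈ b∈ (Adj⇒≢ sG a~b) (inj₂ ≡f))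
      decide (no ≢e) (no ≢f) = inj₁ (avoid⁺ G a~b ≢e ≢f)

  holeThrough : ∀ {e} → ExtraEdge e → ∃ λ S → IsHole G S × e ⊆ S
  holeThrough xe@((u , v , refl , u~v , ¬K) , _) with avoidingPath xe xe u v
  ... | l , path = fromList l , close u~v ¬K (inj₁ refl) path only ,
      pair-⊆ (∈-fromList⁺ (head∈ path)) (∈-fromList⁺ (last∈ path))
    where
    only : ∀ {a b} → a ∈ₗ l → b ∈ₗ l → a ≢ b → pair a b ≡ pair u v ⊎ pair a b ≡ pair u v → pair a b ≡ pair u v
    only _ _ _ (inj₁ eq) = eq
    only _ _ _ (inj₂ eq) = eq

  -- The path closes up to a hole that misses an end of `pair x y`, hence differs from `C`; but both
  -- holes would contain the edge `pair u v`.
  avoidingHole : ∀ {e f C} → Adj G u v → ¬ (u ∈ K × v ∈ K) →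
    (pair u v ≡ e × pair x y ≡ f) ⊎ (pair x y ≡ e × pair u v ≡ f) →
    InducedPath (avoid G e f) u v l → ¬ (x ∈ₗ l × y ∈ₗ l) →
    IsHole G C → pair u v ⊆ C → ¬ (pair x y ⊆ C)
  avoidingHole {u = u} {v} {x} {y} {l} {e} {f} {C} u~v ¬K eqs path notBoth hC uv⊆C xy⊆C =
    disjoint (fromList l) C (close u~v ¬K (closing eqs) path (only eqs)) hC
      (λ S≡C → notBoth (in-l S≡C (xy⊆C (∈-pairˡ x y)) , in-l S≡C (xy⊆C (∈-pairʳ x y))))
      u v (∈-fromList⁺ (head∈ path)) (∈-fromList⁺ (last∈ path))
      (uv⊆C (∈-pairˡ u v)) (uv⊆C (∈-pairʳ u v)) u~v
    where
    in-l : ∀ {z} → fromList l ≡ C → z ∈ C → z ∈ₗ l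
    in-l refl = ∈-fromList⁻ l
    closing : (pair u v ≡ e × pair x y ≡ f) ⊎ (pair x y ≡ e × pair u v ≡ f) → pair u v ≡ e ⊎ pair u v ≡ f
    closing (inj₁ (eq , _)) = inj₁ eq
    closing (inj₂ (_ , eq)) = inj₂ eq
    excluded : ∀ {a b} → a ∈ₗ l → b ∈ₗ l → a ≢ b → ¬ (pair a b ≡ pair x y)
    excluded a∈ b∈ a≢b eq with pair-injective a≢b eq
    ... | inj₁ (refl , refl) = notBoth (a∈ , b∈)
    ... | inj₂ (refl , refl) = notBoth (b∈ , a∈)
    only : (pair u v ≡ e × pair x y ≡ f) ⊎ (pair x y ≡ e × pair u v ≡ f) →
      ∀ {a b} → a ∈ₗ l → b ∈ₗ l → a ≢ b → pair a b ≡ e ⊎ pair a b ≡ f → pair a b ≡ pair u v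
    only (inj₁ (refl , refl)) a∈ b∈ a≢b (inj₁ eq) = eq
    only (inj₁ (refl , refl)) a∈ b∈ a≢b (inj₂ eq) = ⊥-elim (excluded a∈ b∈ a≢b eq)
    only (inj₂ (refl , refl)) a∈ b∈ a≢b (inj₁ eq) = ⊥-elim (excluded a∈ b∈ a≢b eq)
    only (inj₂ (refl , refl)) a∈ b∈ a≢b (inj₂ eq) = eq

  -- Join the ends of e by an induced path avoiding e and f. If it passes through both ends
  -- of f, the part between them closes up with f to a hole without e; otherwise the path
  -- closes up with e to a hole without f.
  extraEdge-unique : ∀ {e f C} → ExtraEdge e → ExtraEdge f → IsHole G C → e ⊆ C → f ⊆ C → e ≡ f
  extraEdge-unique {e} {f} xe@((u , v , refl , u~v , ¬K) , _) xf@((a , b , refl , a~b , ¬K′) , _)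
    hC e⊆C f⊆C with e ≟ₛ f
  ... | yes e≡f = e≡f
  ... | no e≢f with avoidingPath xe xf u v
  ...   | l , path with a ∈ₗ? l | b ∈ₗ? l
  ...     | no a∉ | _     = ⊥-elim (avoidingHole u~v ¬K (inj₁ (refl , refl)) path (a∉ ∘ proj₁) hC e⊆C f⊆C)
  ...     | yes _ | no b∉ = ⊥-elim (avoidingHole u~v ¬K (inj₁ (refl , refl)) path (b∉ ∘ proj₂) hC e⊆C f⊆C)
  ...     | yes a∈ | yes b∈ with subpath path a∈ b∈
  ...       | l′ , inj₁ path′ , _ , ends = ⊥-elim
    (avoidingHole a~b ¬K′ (inj₂ (refl , refl)) path′ (λ (u∈ , v∈) → e≢f (sym (ends u∈ v∈))) hC f⊆C e⊆C)
  ...       | l′ , inj₂ path′ , _ , ends = ⊥-elim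
    (avoidingHole (Adj-sym sG a~b) (λ (b∈K , a∈K) → ¬K′ (a∈K , b∈K)) (inj₂ (refl , pair-comm b a)) path′
      (λ (u∈ , v∈) → e≢f (sym (ends u∈ v∈))) hC (subst (_⊆ _) (pair-comm a b) f⊆C) e⊆C)

-- Counting the outer edges by an injection

module _ {A B : Set} where

  remove : ∀ {y : B} {ys} → y ∈ₗ ys → ∃ λ ys′ →
    length ys ≡ suc (length ys′) × (∀ {z} → z ∈ₗ ys → z ≢ y → z ∈ₗ ys′)
  remove {ys = _ ∷ ys} (here refl) = ys , refl ,
    λ { (here refl) z≢ → ⊥-elim (z≢ refl) ; (there z∈) _ → z∈ }
  remove (there y∈) with remove y∈
  ... | ys′ , eq , keep = _ ∷ ys′ , cong suc eq ,
    λ { (here refl) _ → here refl ; (there z∈) z≢ → there (keep z∈ z≢) }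

  pigeonhole : ∀ {R : A → B → Set} {xs ys} → Unique xs →
    (∀ {x} → x ∈ₗ xs → ∃ λ y → y ∈ₗ ys × R x y) →
    (∀ {x x′ y} → R x y → R x′ y → x ≡ x′) → length xs ≤ length ys
  pigeonhole [] _ _ = z≤n
  pigeonhole {xs = x ∷ xs} {ys} (x∉ ∷ uniq) image inj with image (here refl)
  ... | y , y∈ , Rxy with remove y∈
  ...   | ys′ , eq , keep rewrite eq = s≤s (pigeonhole uniq image′ inj)
    where
    image′ : ∀ {x′} → x′ ∈ₗ xs → ∃ λ y′ → y′ ∈ₗ ys′ × _
    image′ x′∈ with image (there x′∈)
    ... | y′ , y′∈ , Rx′y′ = y′ , keep y′∈ (λ { refl → All.lookup x∉ x′∈ (inj Rxy Rx′y′) }) , Rx′y′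

module _ {G : Graph n} (sG : Simple G) {K : Subset n} (clique : IsClique G K)
  (triangle⊆K : ∀ {u v w} → Adj G u v → Adj G u w → Adj G w v → u ∈ K × v ∈ K)
  (disjoint : HolesEdgeDisjoint G)
  {P : List (Subset n)} (spanning : ∀ u v → Star (Link G K P) u v) where
  open Extra sG clique triangle⊆K disjoint spanning

  -- Edges in `P` go to themselves and extra edges to a hole through them, all inside the disjoint
  -- sum of `P` and the holes. No hole is hit twice, by `extraEdge-unique`.
  outerEdges-bound : ∀ {h} → HoleCount G h → ∀ {es} → Unique es →
    (∀ {e} → e ∈ₗ es → OuterEdge G K e) → length es ≤ length P + h
  outerEdges-bound (L , _ , holes , refl) {es} uniq outer =
    subst (length es ≤_) (trans (length-++ (map inj₁ P)) (cong₂ _+_ (length-map inj₁ P) (length-map inj₂ L)))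
      (pigeonhole {R = R} uniq image injective)
    where
    R : Subset n → Subset n ⊎ Subset n → Set
    R e (inj₁ e′) = e ≡ e′
    R e (inj₂ S)  = ExtraEdge e × IsHole G S × e ⊆ S

    image : ∀ {e} → e ∈ₗ es → ∃ λ y → y ∈ₗ map inj₁ P ++ map inj₂ L × R e y
    image {e} e∈ with e ∈ₛ? P
    ... | yes e∈P = inj₁ e , ∈-++⁺ˡ (∈-map⁺ inj₁ e∈P) , refl
    ... | no e∉P with holeThrough (outer e∈ , e∉P)
    ...   | S , hS , e⊆S = inj₂ S ,
      ∈-++⁺ʳ (map inj₁ P) (∈-map⁺ inj₂ (Equivalence.from (holes S) hS)) , (outer e∈ , e∉P) , hS , e⊆S

    injective : ∀ {e e′ y} → R e y → R e′ y → e ≡ e′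
    injective {y = inj₁ _} refl refl = refl
    injective {y = inj₂ S} (xe , hS , e⊆S) (xe′ , _ , e′⊆S) = extraEdge-unique xe xe′ hS e⊆S e′⊆S

-- Connecting the graph by `K` and few edges

crossing : ∀ {G : Graph n} (S : Subset n) → Star (Adj G) x y → x ∉ S → y ∈ S →
  ∃₂ λ a b → a ∉ S × b ∈ S × Adj G a b
crossing S ε x∉ y∈ = ⊥-elim (x∉ y∈)
crossing S (_◅_ {j = z} x~z w) x∉ y∈ with z ∈? S
... | yes z∈ = _ , z , x∉ , z∈ , x~z
... | no z∉  = crossing S w z∉ y∈

module _ {G : Graph n} (connected : Connected G) {K : Subset n} {k : Fin n} (k∈K : k ∈ K) where

  private
    Reaches : List (Subset n) → Fin n → Set
    Reaches P v = Star (Link G K P) v k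

    extend : ∀ {e P} → Reaches P v → Reaches (e ∷ P) v
    extend = Star.map λ { (inj₁ q) → inj₁ q ; (inj₂ (q , e∈)) → inj₂ (q , there e∈) }

    -- Each round adds to `S` one vertex and to `P` the edge by which it enters `S`. The fuel `m`
    -- bounds the number of vertices still missing.
    grow : ∀ m P (S : Subset n) → n ≤ m + ∣ S ∣ → ∣ S ∣ ≡ length P + ∣ K ∣ → k ∈ S →
      (∀ v → v ∈ S → Reaches P v) → ∃ λ P → length P + ∣ K ∣ ≤ n × (∀ v → Reaches P v)
    grow m P S n≤ eq k∈S reach with any? (λ x → ¬? (x ∈? S))
    ... | no none = P , subst (_≤ n) eq (∣p∣≤n S) ,
      λ v → reach v (decidable-stable (v ∈? S) (λ v∉ → none (v , v∉)))
    ... | yes (x , x∉) with crossing S (connected x k) x∉ k∈S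
    ...   | a , b , a∉ , b∈ , a~b = next m n≤
      where
      S′ = ⁅ a ⁆ ∪ S
      ∣S′∣ : ∣ S′ ∣ ≡ suc ∣ S ∣
      ∣S′∣ = ∣⁅x⁆∪p∣ a S a∉
      reach′ : ∀ v → v ∈ S′ → Reaches (pair a b ∷ P) v
      reach′ v v∈ with x∈p∪q⁻ ⁅ a ⁆ S v∈
      ... | inj₁ v∈a with x∈⁅y⁆⇒x≡y a v∈a
      ...   | refl = inj₂ (a~b , here refl) ◅ extend (reach b b∈)
      reach′ v v∈ | inj₂ v∈S = extend (reach v v∈S)
      next : ∀ m → n ≤ m + ∣ S ∣ → _
      next zero    n≤ = ⊥-elim (<⇒≱ (subst (_≤ n) ∣S′∣ (∣p∣≤n S′)) n≤)
      next (suc m) n≤ = grow m (pair a b ∷ P) S′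
        (subst (n ≤_) (trans (sym (+-suc m ∣ S ∣)) (cong (m +_) (sym ∣S′∣))) n≤)
        (trans ∣S′∣ (cong suc eq)) (x∈p∪q⁺ (inj₂ k∈S)) reach′

  spanningList : Simple G → ∃ λ P → length P + ∣ K ∣ ≤ n × (∀ u v → Star (Link G K P) u v)
  spanningList sG with grow n [] K (m≤m+n n _) refl k∈K toK
    where
    toK : ∀ v → v ∈ K → Reaches [] v
    toK v v∈ with v ≟ k
    ... | yes refl = ε
    ... | no v≢k = inj₁ (v∈ , k∈K , v≢k) ◅ ε
  ... | P , len , reach = P , len , λ u v → reach u ◅◅ Star.reverse flip-Link (reach v)
    where
    flip-Link : ∀ {u v} → Link G K P u v → Link G K P v u
    flip-Link (inj₁ (u∈ , v∈ , u≢v)) = inj₁ (v∈ , u∈ , u≢v ∘ sym)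
    flip-Link {u} {v} (inj₂ (u~v , uv∈)) = inj₂ (Adj-sym sG u~v , subst (_∈ₗ P) (pair-comm u v) uv∈)

-- Maximal cliques

-- Greedily add a vertex adjacent to all of `Q`; when there is none, `Q` is maximal. The number `m`
-- is fuel.
maximalExtension : ∀ {G : Graph n} → Simple G → ∀ m Q → n ≤ m + ∣ Q ∣ → IsClique G Q →
  ∃ λ M → IsMaximalClique G M × Q ⊆ M
maximalExtension {n} {G} sG m Q n≤ clique
  with any? (λ x → ¬? (x ∈? Q) ×-dec all? (λ y → (y ∈? Q) →-dec (G x y Bool.≟ true)))
... | no none = Q , (clique , maximal) , λ x∈ → x∈
  where
  maximal : ∀ K′ → IsClique G K′ → Q ⊆ K′ → K′ ⊆ Q
  maximal K′ clique′ Q⊆K′ {x} x∈K′ = decidable-stable (x ∈? Q) λ x∉Q →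
    none (x , x∉Q , λ y y∈Q → clique′ x y x∈K′ (Q⊆K′ y∈Q) λ { refl → x∉Q y∈Q })
... | yes (x , x∉Q , x~Q) = next m n≤
  where
  Q′ = ⁅ x ⁆ ∪ Q
  ∣Q′∣ : ∣ Q′ ∣ ≡ suc ∣ Q ∣
  ∣Q′∣ = ∣⁅x⁆∪p∣ x Q x∉Q
  clique′ : IsClique G Q′
  clique′ y z y∈ z∈ y≢z with x∈p∪q⁻ ⁅ x ⁆ Q y∈ | x∈p∪q⁻ ⁅ x ⁆ Q z∈
  ... | inj₂ y∈Q | inj₂ z∈Q = clique y z y∈Q z∈Q y≢z
  ... | inj₁ y∈x | inj₂ z∈Q rewrite x∈⁅y⁆⇒x≡y x y∈x = x~Q z z∈Q
  ... | inj₂ y∈Q | inj₁ z∈x rewrite x∈⁅y⁆⇒x≡y x z∈x = Adj-sym sG (x~Q y y∈Q)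
  ... | inj₁ y∈x | inj₁ z∈x = ⊥-elim (y≢z (trans (x∈⁅y⁆⇒x≡y x y∈x) (sym (x∈⁅y⁆⇒x≡y x z∈x))))
  next : ∀ m → n ≤ m + ∣ Q ∣ → ∃ λ M → IsMaximalClique G M × Q ⊆ M
  next zero    n≤ = ⊥-elim (<⇒≱ (subst (_≤ n) ∣Q′∣ (∣p∣≤n Q′)) n≤)
  next (suc m) n≤ with maximalExtension sG m Q′
    (subst (n ≤_) (trans (sym (+-suc m ∣ Q ∣)) (cong (m +_) (sym ∣Q′∣))) n≤) clique′
  ... | M , max , Q′⊆M = M , max , λ y∈ → Q′⊆M (x∈p∪q⁺ (inj₂ y∈))

-- A maximal clique `M` around the triangle has at least 3 vertices, so the maximum clique `K` has
-- too. Both are maximal and non-edge, hence equal.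
triangle⊆K : ∀ {G : Graph n} → Simple G → AtMostOneNonEdgeMaximalClique G →
  ∀ {K} → IsClique G K → (∀ Q → IsClique G Q → ∣ Q ∣ ≤ ∣ K ∣) →
  ∀ {u v w} → Adj G u v → Adj G u w → Adj G w v → u ∈ K × v ∈ K
triangle⊆K {n} {G} sG atMostOne {K} clique largest {u} {v} {w} u~v u~w w~v
  with maximalExtension sG n (fromList T) (m≤m+n n _) T-clique
  where
  T = u ∷ v ∷ w ∷ []
  T-clique : IsClique G (fromList T)
  T-clique x y x∈ y∈ = adjacent (∈-fromList⁻ T x∈) (∈-fromList⁻ T y∈)
    where
    adjacent : ∀ {x y} → x ∈ₗ T → y ∈ₗ T → x ≢ y → Adj G x y
    adjacent (here refl) (here refl) x≢y = ⊥-elim (x≢y refl)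
    adjacent (here refl) (there (here refl)) _ = u~v
    adjacent (here refl) (there (there (here refl))) _ = u~w
    adjacent (there (here refl)) (here refl) _ = Adj-sym sG u~v
    adjacent (there (here refl)) (there (here refl)) x≢y = ⊥-elim (x≢y refl)
    adjacent (there (here refl)) (there (there (here refl))) _ = Adj-sym sG w~v
    adjacent (there (there (here refl))) (here refl) _ = Adj-sym sG u~w
    adjacent (there (there (here refl))) (there (here refl)) _ = w~v
    adjacent (there (there (here refl))) (there (there (here refl))) x≢y = ⊥-elim (x≢y refl)
... | M , M-max@(M-clique , _) , T⊆M =
    subst (λ Q → u ∈ Q × v ∈ Q) (atMostOne M K M-max 3≤M K-max (≤-trans 3≤M (largest M M-clique)))
      (T⊆M (∈-fromList⁺ {l = T} (here refl)) , T⊆M (∈-fromList⁺ {l = T} (there (here refl))))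
  where
  T = u ∷ v ∷ w ∷ []
  3≤M : 3 ≤ ∣ M ∣
  3≤M = subst (_≤ ∣ M ∣)
    (∣fromList∣ {l = T} ((Adj⇒≢ sG u~v ∷ Adj⇒≢ sG u~w ∷ []) ∷ (Adj⇒≢ sG w~v ∘ sym ∷ []) ∷ [] ∷ []))
    (p⊆q⇒∣p∣≤∣q∣ T⊆M)
  K-max : IsMaximalClique G K
  K-max = clique , λ K′ clique′ K⊆K′ {x} x∈K′ → decidable-stable (x ∈? K) λ x∉K →
    <⇒≱ (p⊂q⇒∣p∣<∣q∣ (K⊆K′ , x , x∈K′ , x∉K)) (largest K′ clique′)

-- Acyclic digraphs from orderings

-- Positions are counted from the end of the list, so that consing does not change them.
data At {A : Set} : List A → ℕ → A → Set where
  newest : ∀ {x xs} → At (x ∷ xs) (length xs) x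
  older  : ∀ {x y xs i} → At xs i x → At (y ∷ xs) i x

module _ {A : Set} where

  At-< : ∀ {xs : List A} {i x} → At xs i x → i < length xs
  At-< newest     = ≤-refl
  At-< (older at) = m≤n⇒m≤1+n (At-< at)

  At-functional : ∀ {xs : List A} {i x y} → At xs i x → At xs i y → x ≡ y
  At-functional newest     newest     = refl
  At-functional newest     (older q)  = ⊥-elim (<-irrefl refl (At-< q))
  At-functional (older p)  newest     = ⊥-elim (<-irrefl refl (At-< p))
  At-functional (older p)  (older q)  = At-functional p q

  At⇒∈ : ∀ {xs : List A} {i x} → At xs i x → x ∈ₗ xs
  At⇒∈ newest    = here refl
  At⇒∈ (older p) = there (At⇒∈ p)

  ∈⇒At : ∀ {xs : List A} {x} → x ∈ₗ xs → ∃ λ i → At xs i x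
  ∈⇒At (here refl) = _ , newest
  ∈⇒At (there x∈)  = _ , older (proj₂ (∈⇒At x∈))

  At-injective : ∀ {xs : List A} {i j x} → Unique xs → At xs i x → At xs j x → i ≡ j
  At-injective _        newest    newest    = refl
  At-injective (x∉ ∷ _) newest    (older q) = ⊥-elim (All.lookup x∉ (At⇒∈ q) refl)
  At-injective (x∉ ∷ _) (older p) newest    = ⊥-elim (All.lookup x∉ (At⇒∈ p) refl)
  At-injective (_ ∷ u)  (older p) (older q) = At-injective u p q

  At-total : ∀ (xs : List A) {i} → i < length xs → ∃ (At xs i)
  At-total (x ∷ xs) {i} i< with i <? length xs
  ... | yes i<′ = _ , older (proj₂ (At-total xs i<′))
  ... | no i≮ with ≤-antisym (≤-pred i<) (≮⇒≥ i≮)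
  ...   | refl = x , newest

-- The j-th set lies within the first 2 + j vertices, so it may prey on position 2 + j.
Timed : List (Fin n) → List (Subset n) → Set
Timed vs cs = ∀ {j C x} → At cs j C → x ∈ C → ∃ λ i → i < 2 + j × At vs i x

-- The new set gets index `length cs`, at which all of `vs` is already available.
Timed-∷ : ∀ {vs : List (Fin n)} {cs C} → Timed vs cs → length vs ≤ 2 + length cs → (∀ {x} → x ∈ C → x ∈ₗ vs) →
  Timed vs (C ∷ cs)
Timed-∷ timed len C⊆ newest x∈ with ∈⇒At (C⊆ x∈)
... | i , at = i , <-≤-trans (At-< at) len , at
Timed-∷ timed len C⊆ (older at) x∈ = timed at x∈

Timed-++ : ∀ {vs : List (Fin n)} {cs} ds → Timed vs cs → length vs ≤ 2 + length cs →
  (∀ {C x} → C ∈ₗ ds → x ∈ C → x ∈ₗ vs) → Timed vs (ds ++ cs)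
Timed-++ []       timed len _  = timed
Timed-++ {cs = cs} (d ∷ ds) timed len ds⊆ =
  Timed-∷ (Timed-++ ds timed len (ds⊆ ∘ there))
    (≤-trans len (s≤s (s≤s (subst (length cs ≤_) (sym (length-++ ds)) (m≤n+m _ _))))) (ds⊆ (here refl))

length-full : ∀ {l : List (Fin n)} → Unique l → (∀ x → x ∈ₗ l) → length l ≡ n
length-full {n} {l} uniq full = trans (sym (∣fromList∣ uniq))
  (≤-antisym (∣p∣≤n (fromList l))
    (subst (_≤ ∣ fromList l ∣) (∣⊤∣≡n n) (p⊆q⇒∣p∣≤∣q∣ {p = ⊤} λ {x} _ → ∈-fromList⁺ (full x))))

module _ {G : Graph n} {vs cs} (uniq : Unique vs) (full : ∀ x → x ∈ₗ vs) (timed : Timed vs cs)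
  (cliques : ∀ {C} → C ∈ₗ cs → IsClique G C)
  (cover : ∀ {u v} → Adj G u v → ∃ λ C → C ∈ₗ cs × u ∈ C × v ∈ C)
  (k : ℕ) (short : 2 + length cs ≤ n + k) where

  private
    -- Old vertices are ranked by position in `vs`, and the new ones follow from `n` on.
    data Rank : Fin (n + k) → ℕ → Set where
      old : ∀ {v i} → At vs i v → Rank (v ↑ˡ k) i
      new : ∀ i → Rank (n ↑ʳ i) (n + toℕ i)

    Rank-functional : ∀ {w w′ i j} → w ≡ w′ → Rank w i → Rank w′ j → i ≡ j
    Rank-functional eq (old p) (old q) with ↑ˡ-injective k _ _ eq
    ... | refl = At-injective uniq p q
    Rank-functional eq (old {v} _) (new i)
      with trans (sym (splitAt-↑ˡ n v k)) (trans (cong (splitAt n) eq) (splitAt-↑ʳ n k i))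
    ... | ()
    Rank-functional eq (new i) (old {v} _)
      with trans (sym (splitAt-↑ˡ n v k)) (trans (cong (splitAt n) (sym eq)) (splitAt-↑ʳ n k i))
    ... | ()
    Rank-functional eq (new i) (new j) with ↑ʳ-injective n _ _ eq
    ... | refl = refl

    Rank-total : ∀ {i} → i < n + k → ∃ λ w → Rank w i
    Rank-total {i} i< with i <? length vs
    ... | yes i<′ = _ , old (proj₂ (At-total vs i<′))
    ... | no i≮ = n ↑ʳ fromℕ< i∸n<k , subst (Rank _) (trans (cong (n +_) (toℕ-fromℕ< i∸n<k)) eq) (new (fromℕ< i∸n<k))
      where
      n≤i : n ≤ i
      n≤i = subst (_≤ i) (length-full uniq full) (≮⇒≥ i≮)
      eq : n + (i ∸ n) ≡ i
      eq = m+[n∸m]≡n n≤i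
      i∸n<k : i ∸ n < k
      i∸n<k = +-cancelˡ-< n (i ∸ n) k (subst (_< n + k) (sym eq) i<)

    -- Arcs go up in rank, because `Timed` keeps the members of the `j`-th set below position
    -- `2 + j`. Sets with different indices have different prey, so two vertices share prey only if
    -- they share a set.
    D : Digraph (n + k)
    D x w = ∃ λ j → ∃₂ λ C a → At cs j C × a ∈ C × x ≡ a ↑ˡ k × Rank w (2 + j)

    increasing : ∀ {x y} → TransClosure D x y → ∃₂ λ i j → Rank x i × Rank y j × i < j
    increasing [ j , C , a , at , a∈ , refl , rank ] with timed at a∈
    ... | i , i< , at′ = i , 2 + j , old at′ , rank , i<
    increasing ((j , C , a , at , a∈ , refl , rank) ∷ path) with timed at a∈ | increasing path
    ... | i , i< , at′ | i₂ , j₂ , rank′ , rank″ , i₂<j₂ =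
      i , j₂ , old at′ , rank″ , <-trans (subst (i <_) (Rank-functional refl rank rank′) i<) i₂<j₂

    acyclic : Acyclic D
    acyclic x cycle with increasing cycle
    ... | i , j , rank , rank′ , i<j = <-irrefl (Rank-functional refl rank rank′) i<j

    isolated-Adj : ∀ a b → addIsolated G k (a ↑ˡ k) (b ↑ˡ k) ≡ G a b
    isolated-Adj a b rewrite splitAt-↑ˡ n a k | splitAt-↑ˡ n b k = refl

    isolated-ends : ∀ x y → Adj (addIsolated G k) x y →
      ∃₂ λ a b → x ≡ a ↑ˡ k × y ≡ b ↑ˡ k × Adj G a b
    isolated-ends x y x~y with splitAt n x in eqx | splitAt n y in eqy
    ... | inj₁ a | inj₁ b = a , b , sym (splitAt⁻¹-↑ˡ eqx) , sym (splitAt⁻¹-↑ˡ eqy) , x~y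

    competition : IsCompetitionGraph (addIsolated G k) D
    competition x y x≢y = mk⇔ to from
      where
      to : Adj (addIsolated G k) x y → ∃ λ w → D x w × D y w
      to x~y with isolated-ends x y x~y
      ... | a , b , refl , refl , a~b with cover a~b
      ...   | C , C∈ , a∈ , b∈ with ∈⇒At C∈
      -- This is where `short` enters: since `j < length cs`, a vertex of rank `2 + j` exists.
      ...     | j , at with Rank-total {2 + j} (≤-trans (s≤s (s≤s (At-< at))) short)
      ...       | w , rank = w , (j , C , a , at , a∈ , refl , rank) , (j , C , b , at , b∈ , refl , rank)
      from : (∃ λ w → D x w × D y w) → Adj (addIsolated G k) x y
      from (w , (j , C , a , at , a∈ , refl , rank) , (j′ , C′ , b , at′ , b∈ , refl , rank′))
        with suc-injective (suc-injective (Rank-functional refl rank rank′))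
      ... | refl with At-functional at at′
      ...   | refl = trans (isolated-Adj a b) (cliques (At⇒∈ at) a b a∈ b∈ λ { refl → x≢y refl })

  represent : CompRepresentable G k
  represent = D , acyclic , competition

-- Ordering the vertices

x∉p-x : ∀ (p : Subset n) x → x ∉ p - x
x∉p-x (s ∷ p) (suc x) (there x∈) = x∉p-x p x x∈

∈∈≢⇒2≤length : ∀ {A : Set} {a b : A} {xs} → a ∈ₗ xs → b ∈ₗ xs → a ≢ b → 2 ≤ length xs
∈∈≢⇒2≤length (here refl) (here refl) a≢b = ⊥-elim (a≢b refl)
∈∈≢⇒2≤length (here _)    (there b∈)  _   = s≤s (∈-length b∈)
∈∈≢⇒2≤length (there a∈)  (here _)    _   = s≤s (∈-length a∈)
∈∈≢⇒2≤length (there a∈)  (there b∈)  a≢b = m≤n⇒m≤1+n (∈∈≢⇒2≤length a∈ b∈ a≢b)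

allEqual⇒length≤1 : ∀ {A : Set} {xs : List A} → Unique xs →
  (∀ {a b} → a ∈ₗ xs → b ∈ₗ xs → a ≡ b) → length xs ≤ 1
allEqual⇒length≤1 []      _ = z≤n
allEqual⇒length≤1 (_ ∷ []) _ = s≤s z≤n
allEqual⇒length≤1 ((x≢y ∷ _) ∷ _ ∷ _) same = ⊥-elim (x≢y (same (here refl) (there (here refl))))

module Layouts (H : Graph n) (sH : Simple H) where

  IsEdge : Subset n → Set
  IsEdge C = ∃₂ λ u v → C ≡ pair u v × Adj H u v

  -- Empty sets are padding: they cover nothing, but raise the index of every later set and so give
  -- it more room under `Timed`.
  record Layout (vs : List (Fin n)) (cs : List (Subset n)) : Set where
    field
      unique   : Unique vs
      timed    : Timed vs cs
      complete : ∀ {u v} → u ∈ₗ vs → v ∈ₗ vs → Adj H u v → pair u v ∈ₗ cs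
      kinds    : ∀ {C} → C ∈ₗ cs → C ≡ ⊥ ⊎ IsEdge C
  open Layout

  -- Without padding or repetition, `length cs` is a number of edges, to which the bound on outer
  -- edges applies.
  Exact : List (Subset n) → Set
  Exact cs = Unique cs × (∀ {C} → C ∈ₗ cs → IsEdge C)

  neighbours : Fin n → List (Fin n) → List (Fin n)
  neighbours v = filter (λ u → H v u Bool.≟ true)

  deg : Fin n → List (Fin n) → ℕ
  deg v vs = length (neighbours v vs)

  attach : Fin n → List (Fin n) → List (Subset n) → List (Subset n)
  attach v vs cs = map (pair v) (neighbours v vs) ++ cs

  length-attach : ∀ v vs cs → length (attach v vs cs) ≡ deg v vs + length cs
  length-attach v vs cs =
    trans (length-++ (map (pair v) (neighbours v vs))) (cong (_+ length cs) (length-map (pair v) (neighbours v vs)))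

  ∈-attach⁻ : ∀ {v vs cs C} → C ∈ₗ attach v vs cs →
    (∃ λ u → u ∈ₗ vs × Adj H v u × C ≡ pair v u) ⊎ C ∈ₗ cs
  ∈-attach⁻ {v} {vs} C∈ with ∈-++⁻ (map (pair v) (neighbours v vs)) C∈
  ... | inj₂ C∈cs = inj₂ C∈cs
  ... | inj₁ C∈new with ∈-map⁻ (pair v) C∈new
  ...   | u , u∈ , eq with ∈-filter⁻ (λ u → H v u Bool.≟ true) {xs = vs} u∈
  ...     | u∈vs , v~u = inj₁ (u , u∈vs , v~u , eq)

  ∈-attach⁺ : ∀ {v vs cs u} → u ∈ₗ vs → Adj H v u → pair v u ∈ₗ attach v vs cs
  ∈-attach⁺ {v} u∈ v~u = ∈-++⁺ˡ (∈-map⁺ (pair v) (∈-filter⁺ (λ u → H v u Bool.≟ true) u∈ v~u))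

  empty : Layout [] []
  empty = record { unique = [] ; timed = λ () ; complete = λ () ; kinds = λ () }

  -- With `v` there are at most `2 + length cs` vertices, so the next index, `length cs`, already
  -- admits sets that contain `v`.
  addVertex : ∀ {v vs cs} → Layout vs cs → v ∉ₗ vs → length vs ≤ suc (length cs) →
    Layout (v ∷ vs) (attach v vs cs)
  addVertex {v} {vs} {cs} L v∉ len = record
    { unique   = All.tabulate (λ { u∈ refl → v∉ u∈ }) ∷ unique L
    ; timed    = Timed-++ (map (pair v) (neighbours v vs)) (λ at x∈ → let i , i< , at′ = timed L at x∈ in i , i< , older at′)
                   (s≤s len) new⊆
    ; complete = complete′
    ; kinds    = kinds′ }
    where
    new⊆ : ∀ {C x} → C ∈ₗ map (pair v) (neighbours v vs) → x ∈ C → x ∈ₗ v ∷ vs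
    new⊆ C∈ x∈ with ∈-map⁻ (pair v) C∈
    ... | u , u∈ , refl with ∈-pair⁻ x∈
    ...   | inj₁ refl = here refl
    ...   | inj₂ refl = there (proj₁ (∈-filter⁻ (λ u → H v u Bool.≟ true) {xs = vs} u∈))
    complete′ : ∀ {a b} → a ∈ₗ v ∷ vs → b ∈ₗ v ∷ vs → Adj H a b → pair a b ∈ₗ attach v vs cs
    complete′ (here refl) (here refl) a~b = ⊥-elim (Adj⇒≢ sH a~b refl)
    complete′ (here refl) (there b∈)  a~b = ∈-attach⁺ b∈ a~b
    complete′ {a} {b} (there a∈) (here refl) a~b =
      subst (_∈ₗ _) (pair-comm b a) (∈-attach⁺ a∈ (Adj-sym sH a~b))
    complete′ (there a∈) (there b∈) a~b = ∈-++⁺ʳ (map (pair v) (neighbours v vs)) (complete L a∈ b∈ a~b)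
    kinds′ : ∀ {C} → C ∈ₗ attach v vs cs → C ≡ ⊥ ⊎ IsEdge C
    kinds′ C∈ with ∈-attach⁻ {vs = vs} C∈
    ... | inj₁ (u , _ , v~u , eq) = inj₂ (v , u , eq , v~u)
    ... | inj₂ C∈cs = kinds L C∈cs

  Exact-attach : ∀ {v vs cs} → Layout vs cs → v ∉ₗ vs → Exact cs → Exact (attach v vs cs)
  Exact-attach {v} {vs} {cs} L v∉ (uniq , edges) =
    Unique.++⁺ (Unique.map⁺ pair-cancel (Unique.filter⁺ (λ u → H v u Bool.≟ true) (unique L))) uniq disjoint , edges′
    where
    pair-cancel : ∀ {a b} → pair v a ≡ pair v b → a ≡ b
    pair-cancel {a} {b} eq with ∈-pair⁻ (subst (a ∈_) eq (∈-pairʳ v a)) | ∈-pair⁻ (subst (b ∈_) (sym eq) (∈-pairʳ v b))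
    ... | inj₂ a≡b  | _         = a≡b
    ... | inj₁ _    | inj₂ b≡a  = sym b≡a
    ... | inj₁ refl | inj₁ refl = refl
    disjoint : ∀ {C} → ¬ (C ∈ₗ map (pair v) (neighbours v vs) × C ∈ₗ cs)
    disjoint (C∈new , C∈cs) with ∈-map⁻ (pair v) C∈new | ∈⇒At C∈cs
    -- `timed` serves here to show that sets in `cs` have members in `vs` only, whereas the new
    -- edges contain `v`.
    ... | u , _ , refl | j , at = v∉ (At⇒∈ (proj₂ (proj₂ (timed L at (∈-pairˡ v u)))))
    edges′ : ∀ {C} → C ∈ₗ attach v vs cs → IsEdge C
    edges′ C∈ with ∈-attach⁻ {vs = vs} C∈
    ... | inj₁ (u , _ , v~u , eq) = v , u , eq , v~u
    ... | inj₂ C∈cs = edges C∈cs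

  addEmpty : ∀ {vs cs} → Layout vs cs → length vs ≤ 2 + length cs → Layout vs (⊥ ∷ cs)
  addEmpty L len = record
    { unique   = unique L
    ; timed    = Timed-∷ (timed L) len (⊥-elim ∘ ∉⊥)
    ; complete = λ u∈ v∈ u~v → there (complete L u∈ v∈ u~v)
    ; kinds    = λ { (here refl) → inj₁ refl ; (there C∈) → kinds L C∈ } }

  TwoNeighbours : Subset n → Fin n → Set
  TwoNeighbours R v = ∃₂ λ a b → (a ∈ R × Adj H v a) × (b ∈ R × Adj H v b) × a ≢ b

  twoNeighbours? : ∀ R v → Dec (TwoNeighbours R v)
  twoNeighbours? R v = any? λ a → any? λ b →
    ((a ∈? R) ×-dec (H v a Bool.≟ true)) ×-dec ((b ∈? R) ×-dec (H v b Bool.≟ true)) ×-dec ¬? (a ≟ b)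

  Covers : List (Fin n) → Subset n → Set
  Covers vs R = (∀ {x} → x ∈ₗ vs → x ∈ R) × (∀ {x} → x ∈ R → x ∈ₗ vs)

  -- Whenever a connected part of R is exhausted, its last vertex brought at least two edges,
  -- which makes up for the first vertex of the next part.
  module Core (R : Subset n) (core : ∀ {v} → v ∈ R → TwoNeighbours R v) where

    Result : Set
    Result = ∃₂ λ vs cs → Layout vs cs × Covers vs R × Exact cs × length vs ≤ suc (length cs)

    mutual
      continue : ∀ m {vs cs} → n ≤ m + length vs → Layout vs cs → (∀ {x} → x ∈ₗ vs → x ∈ R) → Exact cs →
        length vs ≤ length cs → Result
      continue m {vs} {cs} n≤ L vs⊆R exact len with any? (λ v → (v ∈? R) ×-dec ¬? (v ∈ₗ? vs))
      ... | no none = vs , cs , L ,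
        (vs⊆R , λ {x} x∈R → decidable-stable (x ∈ₗ? vs) λ x∉ → none (x , x∈R , x∉)) , exact , m≤n⇒m≤1+n len
      ... | yes (v , v∈R , v∉) =
        place m n≤ L vs⊆R exact v∈R v∉ (m≤n⇒m≤1+n len) (≤-trans len (m≤n+m _ _))

      -- The first inequality permits adding `v`; the second restores the first one afterwards.
      -- Later vertices of a part have an earlier neighbour, which yields the second from the first.
      place : ∀ m {vs cs v} → n ≤ m + length vs → Layout vs cs → (∀ {x} → x ∈ₗ vs → x ∈ R) → Exact cs →
        v ∈ R → v ∉ₗ vs → length vs ≤ suc (length cs) → length vs ≤ deg v vs + length cs → Result
      place zero {vs} {cs} {v} n≤ L vs⊆R exact v∈R v∉ len len′ =
        ⊥-elim (<⇒≱ (subst (_≤ n) (∣fromList∣ (unique L′)) (∣p∣≤n (fromList (v ∷ vs)))) n≤)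
        where L′ = addVertex L v∉ len
      place (suc m) {vs} {cs} {v} n≤ L vs⊆R exact v∈R v∉ len len′ = next
        (any? λ u → (u ∈? R) ×-dec ¬? (u ∈ₗ? (v ∷ vs)) ×-dec
          any? (λ w → (w ∈ₗ? (v ∷ vs)) ×-dec (H u w Bool.≟ true)))
        where
        L′ = addVertex L v∉ len
        exact′ = Exact-attach L v∉ exact
        n≤′ : n ≤ m + suc (length vs)
        n≤′ = subst (n ≤_) (sym (+-suc m _)) n≤
        vs′⊆R : ∀ {x} → x ∈ₗ v ∷ vs → x ∈ R
        vs′⊆R (here refl) = v∈R
        vs′⊆R (there x∈)  = vs⊆R x∈

        next : Dec (∃ λ u → u ∈ R × u ∉ₗ v ∷ vs × ∃ λ w → w ∈ₗ v ∷ vs × Adj H u w) → Result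
        next (yes (u , u∈R , u∉ , w , w∈ , u~w)) = place m n≤′ L′ vs′⊆R exact′ u∈R u∉ len″
          (≤-trans len″ (+-monoˡ-≤ _ (∈-length (∈-filter⁺ (λ w → H u w Bool.≟ true) w∈ u~w))))
          where
          len″ : suc (length vs) ≤ suc (length (attach v vs cs))
          len″ = s≤s (subst (length vs ≤_) (sym (length-attach v vs cs)) len′)
        -- Nothing in `R` outside the list is adjacent to it, so both neighbours of `v` given by
        -- `core` come earlier. These two edges gain one on the vertex count.
        next (no closed) = continue m n≤′ L′ vs′⊆R exact′
          (subst (suc (length vs) ≤_) (sym (length-attach v vs cs))
            (≤-trans (s≤s len) (+-monoˡ-≤ (length cs) 2≤deg)))
          where
          nbr∈ : ∀ {a} → a ∈ R × Adj H v a → a ∈ₗ neighbours v vs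
          nbr∈ {a} (a∈R , v~a) with decidable-stable (a ∈ₗ? (v ∷ vs))
            (λ a∉ → closed (a , a∈R , a∉ , v , here refl , Adj-sym sH v~a))
          ... | here refl = ⊥-elim (Adj⇒≢ sH v~a refl)
          ... | there a∈  = ∈-filter⁺ (λ u → H v u Bool.≟ true) a∈ v~a
          2≤deg : 2 ≤ deg v vs
          2≤deg = let a , b , a∈ , b∈ , a≢b = core v∈R in ∈∈≢⇒2≤length (nbr∈ a∈) (nbr∈ b∈) a≢b

    result : Result
    result = continue n (m≤m+n n 0) empty (λ ()) ([] , λ ()) z≤n

  -- Either cs lists each edge exactly once, or it is padded with empty sets to length ∣ vs ∣ - 1.
  Outcome : List (Fin n) → List (Subset n) → Set
  Outcome vs cs = (Exact cs × length vs ≤ suc (length cs)) ⊎ (suc (length cs) ≡ length vs)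

  -- Peel off vertices with at most one neighbour in `R` until a core is left, and append them in
  -- reverse. Each brings at most one edge; padding starts only when an edge is missing and no slack
  -- is left.
  layout : ∀ m R → ∣ R ∣ ≤ m → ∃₂ λ vs cs → Layout vs cs × Covers vs R × Outcome vs cs
  layout m R ∣R∣≤m with any? (λ v → (v ∈? R) ×-dec ¬? (twoNeighbours? R v))
  ... | no none =
    let vs , cs , L , covers , exact , len = Core.result R
          (λ {v} v∈ → decidable-stable (twoNeighbours? R v) λ ¬two → none (v , v∈ , ¬two))
    in vs , cs , L , covers , inj₁ (exact , len)
  layout zero R ∣R∣≤m | yes (v , v∈R , ¬two) = ⊥-elim (<⇒≱ (x∈p⇒∣p-x∣<∣p∣ v∈R) (≤-trans ∣R∣≤m z≤n))
  layout (suc m) R ∣R∣≤m | yes (v , v∈R , ¬two)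
    with layout m (R - v) (≤-pred (≤-trans (x∈p⇒∣p-x∣<∣p∣ v∈R) ∣R∣≤m))
  ... | vs , cs , L , (vs⊆ , ⊆vs) , outcome = finish outcome
    where
    v∉ : v ∉ₗ vs
    v∉ v∈ = x∉p-x R v (vs⊆ v∈)
    ∈R : ∀ {x} → x ∈ₗ vs → x ∈ R
    ∈R x∈ = p─q⊆p R ⁅ v ⁆ (vs⊆ x∈)
    covers : Covers (v ∷ vs) R
    covers = (λ { (here refl) → v∈R ; (there x∈) → ∈R x∈ }) , complete-vs
      where
      complete-vs : ∀ {x} → x ∈ R → x ∈ₗ v ∷ vs
      complete-vs {x} x∈ with x ≟ v
      ... | yes refl = here refl
      ... | no x≢v   = there (⊆vs (x∈p∧x≢y⇒x∈p-y x∈ x≢v))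
    deg≤1 : deg v vs ≤ 1
    deg≤1 = allEqual⇒length≤1 (Unique.filter⁺ (λ u → H v u Bool.≟ true) (unique L)) λ {a} {b} a∈ b∈ →
      decidable-stable (a ≟ b) λ a≢b → ¬two (a , b , nbr a∈ , nbr b∈ , a≢b)
      where
      nbr : ∀ {a} → a ∈ₗ neighbours v vs → a ∈ R × Adj H v a
      nbr a∈ = let a∈vs , v~a = ∈-filter⁻ (λ u → H v u Bool.≟ true) {xs = vs} a∈ in ∈R a∈vs , v~a
    tight : suc (length cs) ≡ length vs →
      ∃₂ λ vs cs → Layout vs cs × Covers vs R × Outcome vs cs
    tight eq with deg v vs | deg≤1 | length-attach v vs cs | addVertex L v∉ (≤-reflexive (sym eq))
    ... | 1 | _ | len | L′ = _ , _ , L′ , covers , inj₂ (cong suc (trans len eq))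
    -- A vertex without earlier neighbours is compensated by one empty set.
    ... | 0 | _ | len | L′ = _ , _ , addEmpty L′ (≤-reflexive (cong suc (trans (sym eq) (cong suc (sym len))))) ,
      covers , inj₂ (cong suc (trans (cong suc len) eq))
    ... | suc (suc _) | s≤s () | _ | _
    finish : Outcome vs cs → ∃₂ λ vs cs → Layout vs cs × Covers vs R × Outcome vs cs
    finish (inj₂ eq) = tight eq
    finish (inj₁ (exact , len)) with length vs ≤? length (attach v vs cs)
    ... | yes len′ = _ , _ , addVertex L v∉ len , covers , inj₁ (Exact-attach L v∉ exact , s≤s len′)
    -- `length cs` is at most the length after attaching, which is below `length vs`; with `len`
    -- this forces equality.
    ... | no len≰ = tight (≤-antisym
      (≤-trans (s≤s (≤-trans (m≤n+m _ (deg v vs)) (≤-reflexive (sym (length-attach v vs cs))))) (≰⇒> len≰)) len)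

-- Covering the graph by `K` and the edges outside it

outer : Graph n → Subset n → Graph n
outer G K u v = G u v ∧ not (does (u ∈? K) ∧ does (v ∈? K))

module _ (G : Graph n) (K : Subset n) where

  outer-simple : Simple G → Simple (outer G K)
  outer-simple sG = record
    { irrefl = λ x → cong (_∧ _) (Simple.irrefl sG x)
    ; sym    = λ x y → cong₂ _∧_ (Simple.sym sG x y) (cong not (Bool.∧-comm (does (x ∈? K)) _)) }

  outer⁻ : Adj (outer G K) u v → Adj G u v × ¬ (u ∈ K × v ∈ K)
  outer⁻ {u = u} {v} u~v with G u v | u ∈? K | v ∈? K
  ... | true | no u∉ | _     = refl , u∉ ∘ proj₁
  ... | true | yes _ | no v∉ = refl , v∉ ∘ proj₂

  outer⁺ : Adj G u v → ¬ (u ∈ K × v ∈ K) → Adj (outer G K) u v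
  outer⁺ {u = u} {v} u~v ¬K rewrite u~v with u ∈? K | v ∈? K
  ... | no _   | _      = refl
  ... | yes _  | no _   = refl
  ... | yes u∈ | yes v∈ = ⊥-elim (¬K (u∈ , v∈))

theorem2p7 : ∀ {n} (G : Graph n) (h ω : ℕ) →
    Simple G → Connected G →
    HolesEdgeDisjoint G → AtMostOneNonEdgeMaximalClique G →
    HoleCount G h → CliqueNumber G ω →
    2 ≤ ω → ω ≤ h + 1 →
    CompetitionNumber≤ G (h + 3 ∸ ω)
theorem2p7 {n} G h ω sG connected disjoint atMostOne holes ((K , clique , refl) , largest) 2≤ω ω≤h+1
  with nonempty? K
... | no empty = ⊥-elim (<⇒≱ 2≤ω (≤-trans (≤-reflexive (trans (cong ∣_∣ (Empty-unique empty)) (∣⊥∣≡0 n))) z≤n))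
... | yes (k , k∈K) with spanningList connected k∈K sG
...   | P , P-length , spanning with Layouts.layout (outer G K) (outer-simple G K sG) n ⊤ (∣p∣≤n ⊤)
...     | vs , cs , L , (_ , full) , outcome = r , ≤-refl ,
    represent (unique L) (λ _ → full ∈⊤)
      -- `K` comes last, when every vertex is available.
      (Timed-∷ (timed L) (m≤n⇒m≤1+n (slack outcome)) (λ _ → full ∈⊤))
      cliques cover r (short outcome)
  where
  open Layouts (outer G K) (outer-simple G K sG)
  open Layout
  r = h + 3 ∸ ∣ K ∣

  r+ω : r + ∣ K ∣ ≡ h + 3
  r+ω = m∸n+n≡m (≤-trans ω≤h+1 (+-monoʳ-≤ h (s≤s z≤n)))

  2≤r : 2 ≤ r
  2≤r = +-cancelʳ-≤ ∣ K ∣ 2 r (begin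
    2 + ∣ K ∣   ≤⟨ +-monoʳ-≤ 2 ω≤h+1 ⟩
    2 + (h + 1) ≡⟨ +-comm 2 (h + 1) ⟩
    h + 1 + 2   ≡⟨ +-assoc h 1 2 ⟩
    h + 3       ≡⟨ r+ω ⟨
    r + ∣ K ∣   ∎)
    where open ≤-Reasoning

  slack : Outcome vs cs → length vs ≤ suc (length cs)
  slack (inj₁ (_ , len)) = len
  slack (inj₂ eq) = ≤-reflexive (sym eq)

  short : Outcome vs cs → 3 + length cs ≤ n + r
  -- The 3 counts the positions 0 and 1, which are nobody's prey, and the set `K`.
  short (inj₁ ((uniq , edges) , _)) = begin
    3 + length cs        ≤⟨ +-monoʳ-≤ 3 (outerEdges-bound sG clique (triangle⊆K sG atMostOne clique largest)
                              disjoint spanning holes uniq outerEdge) ⟩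
    3 + (length P + h)   ≡⟨ +-comm 3 (length P + h) ⟩
    length P + h + 3     ≡⟨ +-assoc (length P) h 3 ⟩
    length P + (h + 3)   ≡⟨ cong (length P +_) (trans (sym r+ω) (+-comm r ∣ K ∣)) ⟩
    length P + (∣ K ∣ + r) ≡⟨ +-assoc (length P) ∣ K ∣ r ⟨
    length P + ∣ K ∣ + r ≤⟨ +-monoˡ-≤ r P-length ⟩
    n + r                ∎
    where
    open ≤-Reasoning
    outerEdge : ∀ {e} → e ∈ₗ cs → OuterEdge G K e
    outerEdge e∈ = let u , v , eq , u~v = edges e∈ in u , v , eq , outer⁻ G K u~v
  -- Together with `K` there are `n` sets here, so two new vertices suffice.
  short (inj₂ eq) = begin
    3 + length cs ≡⟨ cong (2 +_) (trans eq (length-full (unique L) (λ _ → full ∈⊤))) ⟩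
    2 + n         ≤⟨ +-monoˡ-≤ n 2≤r ⟩
    r + n         ≡⟨ +-comm r n ⟩
    n + r         ∎
    where open ≤-Reasoning

  cliques : ∀ {C} → C ∈ₗ K ∷ cs → IsClique G C
  cliques (here refl) = clique
  cliques (there C∈) x y x∈ y∈ x≢y with kinds L C∈
  ... | inj₁ refl = ⊥-elim (∉⊥ x∈)
  ... | inj₂ (u , v , refl , u~v) with ∈-pair⁻ x∈ | ∈-pair⁻ y∈
  ...   | inj₁ refl | inj₁ refl = ⊥-elim (x≢y refl)
  ...   | inj₁ refl | inj₂ refl = proj₁ (outer⁻ G K u~v)
  ...   | inj₂ refl | inj₁ refl = Adj-sym sG (proj₁ (outer⁻ G K u~v))
  ...   | inj₂ refl | inj₂ refl = ⊥-elim (x≢y refl)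

  cover : ∀ {u v} → Adj G u v → ∃ λ C → C ∈ₗ K ∷ cs × u ∈ C × v ∈ C
  cover {u} {v} u~v with (u ∈? K) ×-dec (v ∈? K)
  ... | yes (u∈ , v∈) = K , here refl , u∈ , v∈
  ... | no ¬K = pair u v , there (complete L (full ∈⊤) (full ∈⊤) (outer⁺ G K u~v ¬K)) , ∈-pairˡ u v , ∈-pairʳ u v
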